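{- Contextual equivalence $=_{\mathcal C}^{\lambda_{\mathsf{Plot}}}$ of Plotkin's calculus is a scrutable $\lambda_{\mathsf{Plot}}$-theory.
   Context: Plotkin's calculus $\lambda_{\mathsf{Plot}}$. Terms are ordinary $\lambda$-terms $t,u ::= v\mid tu$ with values $v ::= x\mid\lambda x.t$, up to $\alpha$-renaming. Contexts are terms with exactly one hole $\langle\cdot\rangle$ (plugging may capture variables). Reduction $\to_{\lambda_{\mathsf{Plot}}}$ is the closure under all contexts of $(\lambda x.t)v\mapsto t\{x{\leftarrow}v\}$, with $v$ a value and $\{x{\leftarrow}v\}$ capture-avoiding substitution. Contextual equivalence: $t =_{\mathcal C}^{\lambda_{\mathsf{Plot}}} u$ iff for every context $C$ such that $C\langle t\rangle$ and $C\langle u\rangle$ are closed: $C\langle t\rangle \to^*_{\lambda_{\mathsf{Plot}}} v$ for some value $v$ if and only if $C\langle u\rangle\to^*_{\lambda_{\mathsf{Plot}}} v'$ for some value $v'$. A $\lambda_{\mathsf{Plot}}$-theory is an equivalence relation on terms containing $\to_{\lambda_{\mathsf{Plot}}}$ and closed under all contexts. Testing contexts: $T ::= \langle\cdot\rangle \mid (\lambda x.T)t \mid Tt$. A term $t$ is (CbV) scrutable if $T\langle t\rangle\to^*_{\lambda_{\mathsf{Plot}}} v$ for some testing context $T$ and some value $v$, and inscrutable otherwise. A $\lambda_{\mathsf{Plot}}$-theory is scrutable if it equates all inscrutable terms. -}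

module Defs where

open import Data.Nat using (ℕ; zero; suc)
open import Data.Product using (∃; _×_)
open import Function.Bundles using (_⇔_)
open import Level using (Level)
open import Relation.Binary using (Rel; IsEquivalence)
open import Relation.Binary.Construct.Closure.ReflexiveTransitive using (Star)
open import Relation.Nullary using (¬_)

-- Terms up to α-renaming, in de Bruijn style: `var i` refers to the i-th
-- enclosing binder, and indices that exceed the number of enclosing binders
-- are free variables.

infixl 7 _·_

data Term : Set where
  var : ℕ → Term
  ƛ   : Term → Term
  _·_ : Term → Term → Term

data Value : Term → Set where
  var : ∀ x → Value (var x)
  ƛ   : ∀ t → Value (ƛ t)

-- `x ∈fv t`, with x counted from outside t.

data _∈fv_ : ℕ → Term → Set where
  var  : ∀ {x} → x ∈fv var x
  ƛ    : ∀ {x t} → suc x ∈fv t → x ∈fv ƛ t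
  appˡ : ∀ {x t u} → x ∈fv t → x ∈fv (t · u)
  appʳ : ∀ {x t u} → x ∈fv u → x ∈fv (t · u)

Closed : Term → Set
Closed t = ∀ x → ¬ (x ∈fv t)

extʳ : (ℕ → ℕ) → (ℕ → ℕ)
extʳ ρ zero    = zero
extʳ ρ (suc x) = suc (ρ x)

rename : (ℕ → ℕ) → Term → Term
rename ρ (var x) = var (ρ x)
rename ρ (ƛ t)   = ƛ (rename (extʳ ρ) t)
rename ρ (t · u) = rename ρ t · rename ρ u

extˢ : (ℕ → Term) → (ℕ → Term)
extˢ σ zero    = var zero
extˢ σ (suc x) = rename suc (σ x)

subst : (ℕ → Term) → Term → Term
subst σ (var x) = σ x
subst σ (ƛ t)   = ƛ (subst (extˢ σ) t)
subst σ (t · u) = subst σ t · subst σ u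

-- t [ v ] replaces index 0 of t, the variable bound by the λ of `ƛ t`, and
-- lowers the remaining free indices since that λ disappears.

single : Term → ℕ → Term
single v zero    = v
single v (suc x) = var x

infix 8 _[_]

_[_] : Term → Term → Term
t [ v ] = subst (single v) t

data Context : Set where
  ⟨·⟩  : Context
  ƛ    : Context → Context
  _·ˡ_ : Context → Term → Context
  _·ʳ_ : Term → Context → Context

-- The plugged term is not shifted when it goes under a binder, so its free
-- indices are captured.

infix 9 _⟨_⟩

_⟨_⟩ : Context → Term → Term
⟨·⟩      ⟨ t ⟩ = t
ƛ C      ⟨ t ⟩ = ƛ (C ⟨ t ⟩)
(C ·ˡ u) ⟨ t ⟩ = C ⟨ t ⟩ · u
(u ·ʳ C) ⟨ t ⟩ = u · C ⟨ t ⟩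

infix 4 _↦_ _⟶_ _⟶*_ _=𝒞_

data _↦_ : Rel Term Level.zero where
  βᵥ : ∀ {t v} → Value v → ƛ t · v ↦ t [ v ]

data _⟶_ : Rel Term Level.zero where
  inside : ∀ {t u} (C : Context) → t ↦ u → C ⟨ t ⟩ ⟶ C ⟨ u ⟩

_⟶*_ : Rel Term Level.zero
_⟶*_ = Star _⟶_

HasValue : Term → Set
HasValue t = ∃ λ v → Value v × t ⟶* v

_=𝒞_ : Rel Term Level.zero
t =𝒞 u = (C : Context) → Closed (C ⟨ t ⟩) → Closed (C ⟨ u ⟩) →
         HasValue (C ⟨ t ⟩) ⇔ HasValue (C ⟨ u ⟩)

record IsTheory {ℓ : Level} (_≈_ : Rel Term ℓ) : Set ℓ where
  field
    isEquivalence     : IsEquivalence _≈_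
    containsReduction : ∀ {t u} → t ⟶ u → t ≈ u
    contextClosed     : ∀ {t u} (C : Context) → t ≈ u → (C ⟨ t ⟩) ≈ (C ⟨ u ⟩)

data Testing : Context → Set where
  ⟨·⟩ : Testing ⟨·⟩
  β   : ∀ {T} → Testing T → (t : Term) → Testing (ƛ T ·ˡ t)
  app : ∀ {T} → Testing T → (t : Term) → Testing (T ·ˡ t)

Scrutable : Term → Set
Scrutable t = ∃ λ T → Testing T × HasValue (T ⟨ t ⟩)

Inscrutable : Term → Set
Inscrutable t = ¬ Scrutable t

record IsScrutableTheory {ℓ : Level} (_≈_ : Rel Term ℓ) : Set ℓ where
  field
    isTheory           : IsTheory _≈_
    equatesInscrutable : ∀ {t u} → Inscrutable t → Inscrutable u → t ≈ u

{-# OPTIONS --safe #-}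
module Submission where

-- Genericity for inscrutable terms, invariance of HasValue under reduction and
-- completeness of big-step evaluation are instances of one simulation.  The
-- relation _∼_ is the congruence that relates inscrutable terms to everything
-- and is closed under root βᵥ-steps on either side.  It is closed under
-- substitution of values, because an inscrutable term stays inscrutable under
-- such a substitution: a testing context can perform it.  Hence, if a ∼ b and a
-- evaluates, then so does b; an inscrutable subterm is never evaluated.
--
-- Transitivity of contextual equivalence needs one more idea, as the middle
-- term of t =𝒞 u =𝒞 w may be open in a context that closes t and w.  The
-- context is first extended by a testing context that substitutes an identity
-- for all those free variables, which is harmless for t and w.

open import Data.Empty using (⊥-elim)
open import Data.Nat using (ℕ; zero; suc; _+_; _<_; _⊔_; s<s⁻¹)
open import Data.Nat.Properties
  using (<-trans; n<1+n; ≤-trans; m≤m⊔n; m≤n⊔m; <⇒≱; m≤m+n)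
open import Data.Product using (∃; _×_; _,_)
open import Function using (_∘_; _∘′_; id)
open import Function.Bundles using (_⇔_; mk⇔)
import Function.Properties.Equivalence as ⇔
open import Relation.Binary.Construct.Closure.ReflexiveTransitive
  using (ε; _◅_; _◅◅_; gmap)
open import Relation.Binary.PropositionalEquality
  using (_≡_; refl; sym; trans; cong; cong₂; subst₂; module ≡-Reasoning)
  renaming (subst to transport)

open import Defs

-- Substitution calculus

subst-cong-fv : ∀ t {σ τ} → (∀ {x} → x ∈fv t → σ x ≡ τ x) →
                subst σ t ≡ subst τ t
subst-cong-fv (var x) eq = eq var
subst-cong-fv (ƛ t) {σ} {τ} eq = cong ƛ (subst-cong-fv t ext-eq)
  where
  ext-eq : ∀ {x} → x ∈fv t → extˢ σ x ≡ extˢ τ x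
  ext-eq {zero}  _ = refl
  ext-eq {suc x} p = cong (rename suc) (eq (ƛ p))
subst-cong-fv (t · u) eq =
  cong₂ _·_ (subst-cong-fv t (eq ∘ appˡ)) (subst-cong-fv u (eq ∘ appʳ))

subst-cong : ∀ t {σ τ} → (∀ x → σ x ≡ τ x) → subst σ t ≡ subst τ t
subst-cong t eq = subst-cong-fv t (λ {x} _ → eq x)

subst-var : ∀ t → subst var t ≡ t
subst-var (var x) = refl
subst-var (ƛ t)   =
  cong ƛ (trans (subst-cong t λ { zero → refl ; (suc x) → refl }) (subst-var t))
subst-var (t · u) = cong₂ _·_ (subst-var t) (subst-var u)

subst-closed : ∀ {t} σ → Closed t → subst σ t ≡ t
subst-closed {t} σ closed =
  trans (subst-cong-fv t (λ p → ⊥-elim (closed _ p))) (subst-var t)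

rename-as-subst : ∀ ρ t → rename ρ t ≡ subst (var ∘′ ρ) t
rename-as-subst ρ (var x) = refl
rename-as-subst ρ (ƛ t)   =
  cong ƛ (trans (rename-as-subst (extʳ ρ) t)
                (subst-cong t λ { zero → refl ; (suc x) → refl }))
rename-as-subst ρ (t · u) =
  cong₂ _·_ (rename-as-subst ρ t) (rename-as-subst ρ u)

subst-rename : ∀ τ ρ t → subst τ (rename ρ t) ≡ subst (τ ∘ ρ) t
subst-rename τ ρ (var x) = refl
subst-rename τ ρ (ƛ t)   =
  cong ƛ (trans (subst-rename (extˢ τ) (extʳ ρ) t)
                (subst-cong t λ { zero → refl ; (suc x) → refl }))
subst-rename τ ρ (t · u) = cong₂ _·_ (subst-rename τ ρ t) (subst-rename τ ρ u)

rename-extʳ-suc : ∀ ρ t → rename (extʳ ρ) (rename suc t) ≡ rename suc (rename ρ t)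
rename-extʳ-suc ρ t = begin
  rename (extʳ ρ) (rename suc t)         ≡⟨ rename-as-subst (extʳ ρ) (rename suc t) ⟩
  subst (var ∘′ extʳ ρ) (rename suc t)   ≡⟨ subst-rename (var ∘′ extʳ ρ) suc t ⟩
  subst (var ∘′ suc ∘ ρ) t               ≡⟨ subst-rename (var ∘′ suc) ρ t ⟨
  subst (var ∘′ suc) (rename ρ t)        ≡⟨ rename-as-subst suc (rename ρ t) ⟨
  rename suc (rename ρ t)                ∎
  where open ≡-Reasoning

rename-subst : ∀ ρ σ t → rename ρ (subst σ t) ≡ subst (rename ρ ∘ σ) t
rename-subst ρ σ (var x) = refl
rename-subst ρ σ (ƛ t)   =
  cong ƛ (trans (rename-subst (extʳ ρ) (extˢ σ) t)
                (subst-cong t λ { zero → refl ; (suc x) → rename-extʳ-suc ρ (σ x) }))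
rename-subst ρ σ (t · u) = cong₂ _·_ (rename-subst ρ σ t) (rename-subst ρ σ u)

subst-subst : ∀ τ σ t → subst τ (subst σ t) ≡ subst (subst τ ∘ σ) t
subst-subst τ σ (var x) = refl
subst-subst τ σ (ƛ t)   =
  cong ƛ (trans (subst-subst (extˢ τ) (extˢ σ) t)
                (subst-cong t λ { zero → refl ; (suc x) → ext-suc (σ x) }))
  where
  ext-suc : ∀ s → subst (extˢ τ) (rename suc s) ≡ rename suc (subst τ s)
  ext-suc s = trans (subst-rename (extˢ τ) suc s) (sym (rename-subst suc τ s))
subst-subst τ σ (t · u) = cong₂ _·_ (subst-subst τ σ t) (subst-subst τ σ u)

cons : Term → (ℕ → Term) → (ℕ → Term)
cons v σ zero    = v
cons v σ (suc x) = σ x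

-- `extˢ σ` shifts every `σ x` past the new index, and `single v` undoes that shift.
[]-extˢ : ∀ t σ v → subst (extˢ σ) t [ v ] ≡ subst (cons v σ) t
[]-extˢ t σ v =
  trans (subst-subst (single v) (extˢ σ) t)
        (subst-cong t λ { zero    → refl
                        ; (suc x) → trans (subst-rename (single v) suc (σ x))
                                          (subst-var (σ x)) })

subst-[] : ∀ σ t v → subst σ (t [ v ]) ≡ subst (extˢ σ) t [ subst σ v ]
subst-[] σ t v =
  trans (subst-subst σ (single v) t)
        (trans (subst-cong t λ { zero → refl ; (suc x) → refl })
               (sym ([]-extˢ t σ (subst σ v))))

rename-[] : ∀ ρ t v → rename ρ (t [ v ]) ≡ rename (extʳ ρ) t [ rename ρ v ]
rename-[] ρ t v =
  trans (rename-subst ρ (single v) t)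
        (trans (subst-cong t λ { zero → refl ; (suc x) → refl })
               (sym (subst-rename (single (rename ρ v)) (extʳ ρ) t)))

rename-Value : ∀ ρ {v} → Value v → Value (rename ρ v)
rename-Value ρ (var x) = var (ρ x)
rename-Value ρ (ƛ t)   = ƛ (rename (extʳ ρ) t)

Values : (ℕ → Term) → Set
Values σ = ∀ x → Value (σ x)

subst-Value : ∀ {σ} → Values σ → ∀ {v} → Value v → Value (subst σ v)
subst-Value     vσ (var x) = vσ x
subst-Value {σ} vσ (ƛ t)   = ƛ (subst (extˢ σ) t)

extˢ-Values : ∀ {σ} → Values σ → Values (extˢ σ)
extˢ-Values vσ zero    = var zero
extˢ-Values vσ (suc x) = rename-Value suc (vσ x)

-- The count is not lowered under `ƛ`: the bound is strict but need not be tight.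
fvBound : Term → ℕ
fvBound (var x) = suc x
fvBound (ƛ t)   = fvBound t
fvBound (t · u) = fvBound t ⊔ fvBound u

fv<fvBound : ∀ {x t} → x ∈fv t → x < fvBound t
fv<fvBound {x} var = n<1+n x
fv<fvBound (ƛ p)   = <-trans (n<1+n _) (fv<fvBound p)
fv<fvBound {t = t · u} (appˡ p) =
  ≤-trans (fv<fvBound p) (m≤m⊔n (fvBound t) (fvBound u))
fv<fvBound {t = t · u} (appʳ p) =
  ≤-trans (fv<fvBound p) (m≤n⊔m (fvBound t) (fvBound u))

-- Contexts and reduction

infixr 9 _⊚_

_⊚_ : Context → Context → Context
⟨·⟩      ⊚ D = D
ƛ C      ⊚ D = ƛ (C ⊚ D)
(C ·ˡ u) ⊚ D = (C ⊚ D) ·ˡ u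
(u ·ʳ C) ⊚ D = u ·ʳ (C ⊚ D)

⊚-⟨⟩ : ∀ C D t → (C ⊚ D) ⟨ t ⟩ ≡ C ⟨ D ⟨ t ⟩ ⟩
⊚-⟨⟩ ⟨·⟩      D t = refl
⊚-⟨⟩ (ƛ C)    D t = cong ƛ (⊚-⟨⟩ C D t)
⊚-⟨⟩ (C ·ˡ u) D t = cong (_· u) (⊚-⟨⟩ C D t)
⊚-⟨⟩ (u ·ʳ C) D t = cong (u ·_) (⊚-⟨⟩ C D t)

⊚-Testing : ∀ {C D} → Testing C → Testing D → Testing (C ⊚ D)
⊚-Testing ⟨·⟩       D = D
⊚-Testing (β C t)   D = β (⊚-Testing C D) t
⊚-Testing (app C t) D = app (⊚-Testing C D) t

⟶-⟨⟩ : ∀ C {t u} → t ⟶ u → C ⟨ t ⟩ ⟶ C ⟨ u ⟩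
⟶-⟨⟩ C (inside {t} {u} D r) =
  subst₂ _⟶_ (⊚-⟨⟩ C D t) (⊚-⟨⟩ C D u) (inside (C ⊚ D) r)

⟶*-⟨⟩ : ∀ C {t u} → t ⟶* u → C ⟨ t ⟩ ⟶* C ⟨ u ⟩
⟶*-⟨⟩ C = gmap (C ⟨_⟩) (⟶-⟨⟩ C)

HasValue-⟵* : ∀ {t u} → t ⟶* u → HasValue u → HasValue t
HasValue-⟵* r (v , val , s) = v , val , r ◅◅ s

-- Substitution performed by testing contexts

-- The effect of contracting `n` nested redexes: indices below `n` are replaced, and the others drop
-- by `n` because `n` binders disappear.
prefix : ℕ → (ℕ → Term) → (ℕ → Term)
prefix zero    σ = var
prefix (suc n) σ = cons (σ zero) (prefix n (σ ∘ suc))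

prefix-< : ∀ {n x} σ → x < n → prefix n σ x ≡ σ x
prefix-< {suc n} {zero}  σ _   = refl
prefix-< {suc n} {suc x} σ x<n = prefix-< (σ ∘ suc) (s<s⁻¹ x<n)

prefix-+ : ∀ n σ x → prefix n σ (n + x) ≡ var x
prefix-+ zero    σ x = refl
prefix-+ (suc n) σ x = prefix-+ n (σ ∘ suc) x

-- The arguments are shifted past the binders that enclose them.
binding : ℕ → (ℕ → Term) → Context
binding zero    σ = ⟨·⟩
binding (suc n) σ = binding n (σ ∘ suc) ⊚ (ƛ ⟨·⟩ ·ˡ rename (n +_) (σ zero))

binding-Testing : ∀ n σ → Testing (binding n σ)
binding-Testing zero    σ = ⟨·⟩
binding-Testing (suc n) σ = ⊚-Testing (binding-Testing n (σ ∘ suc)) (β ⟨·⟩ _)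

binding-⟶* : ∀ n {σ} → Values σ → ∀ t → binding n σ ⟨ t ⟩ ⟶* subst (prefix n σ) t
binding-⟶* zero        vσ t = transport (t ⟶*_) (sym (subst-var t)) ε
binding-⟶* (suc n) {σ} vσ t =
  transport (_⟶* subst (prefix (suc n) σ) t)
    (sym (⊚-⟨⟩ (binding n σ′) (ƛ ⟨·⟩ ·ˡ w) t))
    -- The `n` outer redexes fire first. Their substitution undoes the shift in `w`, so that the
    -- innermost redex is left with the argument `σ zero`.
    (binding-⟶* n (vσ ∘ suc) (ƛ t · w) ◅◅ step ◅ ε)
  where
  σ′ = σ ∘ suc
  w  = rename (n +_) (σ zero)

  w-subst : subst (prefix n σ′) w ≡ σ zero
  w-subst = trans (subst-rename (prefix n σ′) (n +_) (σ zero))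
                  (trans (subst-cong (σ zero) (prefix-+ n σ′)) (subst-var (σ zero)))

  step : ƛ (subst (extˢ (prefix n σ′)) t) · subst (prefix n σ′) w
           ⟶ subst (prefix (suc n) σ) t
  step rewrite w-subst | sym ([]-extˢ t (prefix n σ′) (σ zero)) =
    inside ⟨·⟩ (βᵥ (vσ zero))

-- Testing contexts compose, so redexes that rebuild `subst σ t` from `t` can be placed in the hole
-- of the given one.
scrutable-subst⁻ : ∀ {t σ} → Values σ → Scrutable (subst σ t) → Scrutable t
scrutable-subst⁻ {t} {σ} vσ (T , testing , hasValue) =
  T ⊚ B , ⊚-Testing testing (binding-Testing n σ) ,
  transport HasValue (sym (⊚-⟨⟩ T B t))
    (HasValue-⟵* (⟶*-⟨⟩ T B⟨t⟩⟶*) hasValue)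
  where
  -- With this many redexes, `prefix n σ` agrees with `σ` on all free variables of `t`.
  n = fvBound t
  B = binding n σ

  B⟨t⟩⟶* : B ⟨ t ⟩ ⟶* subst σ t
  B⟨t⟩⟶* = transport (B ⟨ t ⟩ ⟶*_)
    (subst-cong-fv t (prefix-< σ ∘ fv<fvBound)) (binding-⟶* n vσ t)

inscrutable-subst : ∀ {t σ} → Values σ → Inscrutable t → Inscrutable (subst σ t)
inscrutable-subst vσ ins = ins ∘ scrutable-subst⁻ vσ

inscrutable-rename : ∀ {t} ρ → Inscrutable t → Inscrutable (rename ρ t)
inscrutable-rename {t} ρ ins =
  transport Inscrutable (sym (rename-as-subst ρ t)) (inscrutable-subst (λ x → var (ρ x)) ins)

HasValue⇒scrutable : ∀ {t} → HasValue t → Scrutable t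
HasValue⇒scrutable h = ⟨·⟩ , ⟨·⟩ , h

-- Big-step evaluation

infix 4 _⇓_ _∼_

data _⇓_ : Term → Term → Set where
  val : ∀ {v} → Value v → v ⇓ v
  app : ∀ {t u c w v} → t ⇓ ƛ c → u ⇓ w → c [ w ] ⇓ v → t · u ⇓ v

⇓-Value : ∀ {t v} → t ⇓ v → Value v
⇓-Value (val vv)    = vv
⇓-Value (app _ _ e) = ⇓-Value e

⇓⇒⟶* : ∀ {t v} → t ⇓ v → t ⟶* v
⇓⇒⟶* (val _) = ε
⇓⇒⟶* (app {u = u} {c} d e f) =
  ⟶*-⟨⟩ (⟨·⟩ ·ˡ u) (⇓⇒⟶* d) ◅◅ ⟶*-⟨⟩ (ƛ c ·ʳ ⟨·⟩) (⇓⇒⟶* e) ◅◅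
  inside ⟨·⟩ (βᵥ (⇓-Value e)) ◅ ⇓⇒⟶* f

⇓⇒HasValue : ∀ {t v} → t ⇓ v → HasValue t
⇓⇒HasValue e = _ , ⇓-Value e , ⇓⇒⟶* e

-- The simulation relation

data _∼_ : Term → Term → Set where
  var   : ∀ x → var x ∼ var x
  ƛ     : ∀ {a b} → a ∼ b → ƛ a ∼ ƛ b
  _·_   : ∀ {a b c d} → a ∼ b → c ∼ d → a · c ∼ b · d
  inscr : ∀ {a b} → Inscrutable a → a ∼ b
  βˡ    : ∀ {c v b} → Value v → c [ v ] ∼ b → ƛ c · v ∼ b
  βʳ    : ∀ {a c v} → Value v → a ∼ c [ v ] → a ∼ ƛ c · v

∼-refl : ∀ t → t ∼ t
∼-refl (var x) = var x
∼-refl (ƛ t)   = ƛ (∼-refl t)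
∼-refl (t · u) = ∼-refl t · ∼-refl u

∼-⟨⟩ : ∀ C {a b} → a ∼ b → C ⟨ a ⟩ ∼ C ⟨ b ⟩
∼-⟨⟩ ⟨·⟩      r = r
∼-⟨⟩ (ƛ C)    r = ƛ (∼-⟨⟩ C r)
∼-⟨⟩ (C ·ˡ u) r = ∼-⟨⟩ C r · ∼-refl u
∼-⟨⟩ (u ·ʳ C) r = ∼-refl u · ∼-⟨⟩ C r

⟶⇒∼ : ∀ {t u} → t ⟶ u → t ∼ u
⟶⇒∼ (inside C (βᵥ vv)) = ∼-⟨⟩ C (βˡ vv (∼-refl _))

⟵⇒∼ : ∀ {t u} → t ⟶ u → u ∼ t
⟵⇒∼ (inside C (βᵥ vv)) = ∼-⟨⟩ C (βʳ vv (∼-refl _))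

∼-rename : ∀ ρ {a b} → a ∼ b → rename ρ a ∼ rename ρ b
∼-rename ρ (var x)   = var (ρ x)
∼-rename ρ (ƛ r)     = ƛ (∼-rename (extʳ ρ) r)
∼-rename ρ (r · s)   = ∼-rename ρ r · ∼-rename ρ s
∼-rename ρ (inscr i) = inscr (inscrutable-rename ρ i)
∼-rename ρ (βˡ {c} {v} vv r) =
  βˡ (rename-Value ρ vv) (transport (_∼ _) (rename-[] ρ c v) (∼-rename ρ r))
∼-rename ρ (βʳ {c = c} {v} vv r) =
  βʳ (rename-Value ρ vv) (transport (_ ∼_) (rename-[] ρ c v) (∼-rename ρ r))

-- Since both substitutions consist of values, the arguments in `βˡ` and `βʳ` remain values and the
-- left term in `inscr` remains inscrutable.
∼-subst : ∀ {σ τ} → Values σ → Values τ → (∀ x → σ x ∼ τ x) →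
          ∀ {a b} → a ∼ b → subst σ a ∼ subst τ b
∼-subst vσ vτ σ∼τ (var x) = σ∼τ x
∼-subst vσ vτ σ∼τ (ƛ r)   =
  ƛ (∼-subst (extˢ-Values vσ) (extˢ-Values vτ)
      (λ { zero → var zero ; (suc x) → ∼-rename suc (σ∼τ x) }) r)
∼-subst vσ vτ σ∼τ (r · s)   = ∼-subst vσ vτ σ∼τ r · ∼-subst vσ vτ σ∼τ s
∼-subst vσ vτ σ∼τ (inscr i) = inscr (inscrutable-subst vσ i)
∼-subst {σ} vσ vτ σ∼τ (βˡ {c} {v} vv r) =
  βˡ (subst-Value vσ vv) (transport (_∼ _) (subst-[] σ c v) (∼-subst vσ vτ σ∼τ r))
∼-subst {τ = τ} vσ vτ σ∼τ (βʳ {c = c} {v} vv r) =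
  βʳ (subst-Value vτ vv) (transport (_ ∼_) (subst-[] τ c v) (∼-subst vσ vτ σ∼τ r))

single-Values : ∀ {v} → Value v → Values (single v)
single-Values vv zero    = vv
single-Values vv (suc x) = var x

∼-[] : ∀ {a b v w} → Value v → Value w → a ∼ b → v ∼ w → a [ v ] ∼ b [ w ]
∼-[] vv vw r s =
  ∼-subst (single-Values vv) (single-Values vw) (λ { zero → s ; (suc x) → var x }) r

-- An abstraction is a value, hence scrutable, which excludes `inscr`; `βʳ` would make the right
-- side an application.
∼-ƛ⁻ : ∀ {c v} → Value v → ƛ c ∼ v → ∃ λ d → v ≡ ƛ d × c ∼ d
∼-ƛ⁻ _ (ƛ r)       = _ , refl , r
∼-ƛ⁻ _ (inscr i)   = ⊥-elim (i (HasValue⇒scrutable (_ , ƛ _ , ε)))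
∼-ƛ⁻ () (βʳ _ _)

⇓-βᵥ : ∀ {c v w} → Value v → ƛ c · v ⇓ w → c [ v ] ⇓ w
⇓-βᵥ _       (app (val _) (val _) e) = e
⇓-βᵥ ()      (app (val _) (app _ _ _) _)
⇓-βᵥ _ (val ())

-- Induction on the evaluation, then on the derivation of `_∼_`. Substitution into related bodies
-- may enlarge that derivation, but the evaluation `f` is then a subderivation; only `βʳ` keeps the
-- evaluation, and there the derivation shrinks.
∼-simulates : ∀ {a b v} → a ⇓ v → a ∼ b → ∃ λ w → b ⇓ w × v ∼ w
∼-simulates e (inscr i) = ⊥-elim (i (HasValue⇒scrutable (⇓⇒HasValue e)))
∼-simulates e (βʳ vv r) with ∼-simulates e r
... | w , e′ , s = w , app (val (ƛ _)) (val vv) e′ , s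
∼-simulates (val _) (var x) = _ , val (var x) , var x
∼-simulates (val _) (ƛ r)   = _ , val (ƛ _) , ƛ r
∼-simulates (app d e f) (r · s)
  with ∼-simulates d r | ∼-simulates e s
... | _ , d′ , p | _ , e′ , q with ∼-ƛ⁻ (⇓-Value d′) p
... | _ , refl , p′ with ∼-simulates f (∼-[] (⇓-Value e) (⇓-Value e′) p′ q)
... | w , f′ , s′ = w , app d′ e′ f′ , s′
-- Function and argument are values and evaluate to themselves, so `f` already evaluates the
-- contractum.
∼-simulates (app (val _) (val _) f) (βˡ vv r) = ∼-simulates f r
∼-simulates (app (val _) (app _ _ _) _) (βˡ () _)

-- The sequence is read backwards from its value: a reversed step is an instance of `_∼_`, so
-- evaluability passes from the reduct to the term before it.
⟶*Value⇒⇓ : ∀ {t v} → Value v → t ⟶* v → ∃ (t ⇓_)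
⟶*Value⇒⇓ vv ε       = _ , val vv
⟶*Value⇒⇓ vv (r ◅ s) with ⟶*Value⇒⇓ vv s
... | _ , e with ∼-simulates e (⟵⇒∼ r)
... | w , e′ , _ = w , e′

∼-HasValue : ∀ {a b} → a ∼ b → HasValue a → HasValue b
∼-HasValue r (v , vv , s) with ⟶*Value⇒⇓ vv s
... | _ , e with ∼-simulates e r
... | _ , e′ , _ = ⇓⇒HasValue e′

HasValue-⟶* : ∀ {t u} → t ⟶* u → HasValue t → HasValue u
HasValue-⟶* ε       = id
HasValue-⟶* (r ◅ s) = HasValue-⟶* s ∘ ∼-HasValue (⟶⇒∼ r)

∼⇒=𝒞 : ∀ {t u} → t ∼ u → u ∼ t → t =𝒞 u
∼⇒=𝒞 r s C _ _ = mk⇔ (∼-HasValue (∼-⟨⟩ C r)) (∼-HasValue (∼-⟨⟩ C s))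

-- Closing contexts and transitivity of contextual equivalence

identities : ℕ → Term
identities _ = ƛ (var zero)

closing : ℕ → Context
closing n = binding n identities

-- The arguments are closed, so a free variable can only come from `t`, where it is seen from below
-- `n` binders.
fv-closing : ∀ n {x t} → x ∈fv (closing n ⟨ t ⟩) → (n + x) ∈fv t
fv-closing zero    p = p
fv-closing (suc n) {x} {t} p
  with fv-closing n (transport (x ∈fv_) (⊚-⟨⟩ (closing n) _ t) p)
... | appˡ (ƛ q)  = q
... | appʳ (ƛ ())

closing-closed : ∀ n {t} → Closed t → Closed (closing n ⟨ t ⟩)
closing-closed n closed x = closed (n + x) ∘ fv-closing n

closing-fvBound-closed : ∀ t → Closed (closing (fvBound t) ⟨ t ⟩)
closing-fvBound-closed t x p =
  <⇒≱ (fv<fvBound (fv-closing (fvBound t) p)) (m≤m+n (fvBound t) x)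

-- The redexes substitute into a closed term and thus reduce to that term itself; having a value is
-- invariant under reduction.
closing-HasValue : ∀ n {t} → Closed t → HasValue t ⇔ HasValue (closing n ⟨ t ⟩)
closing-HasValue n {t} closed = mk⇔ (HasValue-⟵* red) (HasValue-⟶* red)
  where
  red : closing n ⟨ t ⟩ ⟶* t
  red = transport (closing n ⟨ t ⟩ ⟶*_) (subst-closed _ closed)
          (binding-⟶* n (λ _ → ƛ (var zero)) t)

=𝒞-⟨⟩ : ∀ D {t u} → t =𝒞 u → D ⟨ t ⟩ =𝒞 D ⟨ u ⟩
=𝒞-⟨⟩ D {t} {u} t=u C
  rewrite sym (⊚-⟨⟩ C D t) | sym (⊚-⟨⟩ C D u) = t=u (C ⊚ D)

=𝒞-trans : ∀ {t u w} → t =𝒞 u → u =𝒞 w → t =𝒞 w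
=𝒞-trans {t} {u} {w} t=u u=w C ct cw =
  ⇔.trans (closing-HasValue n ct)
    (⇔.trans (=𝒞-⟨⟩ C {t} {u} t=u (closing n) (closing-closed n ct) cu)
      (⇔.trans (=𝒞-⟨⟩ C {u} {w} u=w (closing n) cu (closing-closed n cw))
        (⇔.sym (closing-HasValue n cw))))
  where
  -- The bound is that of the middle term, the only one of the three that may be open in `C`.
  n  = fvBound (C ⟨ u ⟩)
  cu = closing-fvBound-closed (C ⟨ u ⟩)

proposition6p3 : IsScrutableTheory _=𝒞_
proposition6p3 = record
  { isTheory = record
    { isEquivalence = record
      { refl  = λ C _ _ → ⇔.refl
      ; sym   = λ t=u C cu ct → ⇔.sym (t=u C ct cu)
      ; trans = λ {t} {u} {w} → =𝒞-trans {t} {u} {w}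
      }
    ; containsReduction = λ r → ∼⇒=𝒞 (⟶⇒∼ r) (⟵⇒∼ r)
    ; contextClosed     = λ {t} {u} C → =𝒞-⟨⟩ C {t} {u}
    }
  ; equatesInscrutable = λ it iu → ∼⇒=𝒞 (inscr it) (inscr iu)
  }
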